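{- Let $\kappa$ be inaccessible and let $b,h:\kappa\to\kappa$ be increasing functions with $h\leq b$, each $b(\alpha)$ an infinite cardinal and each $h(\alpha)$ a nonzero cardinal. Assume: (1) for every regular cardinal $\lambda<\kappa$ the set $\{\alpha\in\kappa\mid\mathrm{cf}(b(\alpha))=\lambda\}$ is bounded in $\kappa$, and there is a club set $C\subseteq\kappa$ such that for each $\xi\in C$ we have $\mathrm{cf}(b(\alpha))>\xi$ for all $\alpha\geq\xi$; (2) for every cardinal $\lambda<\kappa$ the set $\{\alpha\in\kappa\mid h(\alpha)=\lambda\}$ is bounded in $\kappa$, and $h$ is discontinuous on a club set; (3) for every cardinal $\lambda<\kappa$ the set $\{\alpha\in\kappa\mid b(\alpha)\leq\lambda\}\cup\{\alpha\in\kappa\mid h(\alpha)=b(\alpha)\text{ and }\mathrm{cf}(b(\alpha))\leq\lambda\}$ is bounded in $\kappa$, and there is a club set $C\subseteq\kappa$ such that $b$ is discontinuous on $C$ and for each $\xi\in C$ and $\alpha\geq\xi$, if $h(\alpha)=b(\alpha)$, then $\mathrm{cf}(b(\alpha))>\xi$. Then the following Tukey connections exist: $\mathcal{ED}_b\preceq\mathcal{AL}_{b,h}$, $\mathcal{ED}_b\preceq\mathcal D_b$, $\mathcal D_b^\bot\preceq\mathcal D_b$, and $\mathcal{AL}_{b,h}^\bot\preceq\mathcal L_{b,h}$. If additionally $h(\alpha)\leq\mathrm{cf}(b(\alpha))$ for all but boundedly many $\alpha\in\kappa$, then also $\mathcal{AL}_{b,h}\preceq\mathcal D_b$, $\mathcal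 D_b\preceq\mathcal L_{b,h}$, and $\mathcal D_b^\bot\preceq\mathcal{AL}_{b,h}^\bot$.
   Context: "Increasing" means not necessarily strictly increasing. An increasing function $g:\kappa\to\mathrm{Ord}$ is discontinuous on $A\subseteq\kappa$ if $g(\gamma)>\bigcup_{\alpha<\gamma}g(\alpha)$ for every limit ordinal $\gamma\in A$. $\prod b$ is the set of functions $f$ with domain $\kappa$ and $f(\alpha)\in b(\alpha)$ for all $\alpha$. $\mathrm{Loc}_\kappa^{b,h}$ is the set of functions $\phi$ with domain $\kappa$ such that $\phi(\alpha)\subseteq b(\alpha)$ and $|\phi(\alpha)|<h(\alpha)$ for all $\alpha$. "Almost all $\alpha$" means all $\alpha$ above some $\beta<\kappa$; "cofinally many" means unboundedly many in $\kappa$. $f\leq^*g$ iff $f(\alpha)\leq g(\alpha)$ for almost all $\alpha$; $f=^\infty g$ iff $f(\alpha)=g(\alpha)$ for cofinally many $\alpha$; $f\in^*\phi$ iff $f(\alpha)\in\phi(\alpha)$ for almost all $\alpha$; $\phi\ni^\infty f$ iff $f(\alpha)\in\phi(\alpha)$ for cofinally many $\alpha$; $\not=^\infty$ and $\not\ni^\infty$ are the negations of $=^\infty$ and $\ni^\infty$. A relational system is a triple $\mathcal R=\langle X,Y,R\rangle$ with $R\subseteq X\times Y$; its dual is $\mathcal R^\bot=\langle Y,X,\{(y,x)\mid(x,y)\notin R\}\rangle$. A Tukey connection witnessing $\mathcal R\preceq\mathcal R'=\langle X',Y',R'\rangle$ is a pair of functions $\rho_-:X\to X'$, $\rho_+:Y'\to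 Y$ such that for all $x\in X$, $y'\in Y'$, $(\rho_-(x),y')\in R'$ implies $(x,\rho_+(y'))\in R$. The systems are $\mathcal D_b=\langle\prod b,\prod b,\leq^*\rangle$, $\mathcal{ED}_b=\langle\prod b,\prod b,\not=^\infty\rangle$, $\mathcal L_{b,h}=\langle\prod b,\mathrm{Loc}_\kappa^{b,h},\in^*\rangle$, $\mathcal{AL}_{b,h}=\langle\mathrm{Loc}_\kappa^{b,h},\prod b,\not\ni^\infty\rangle$. -}

module Defs where

open import Axiom.ExcludedMiddle using (ExcludedMiddle)
open import Data.Empty using (⊥-elim)
open import Data.Fin.Base using (Fin)
open import Data.Nat.Base using (ℕ)
open import Data.Product.Base using (Σ; ∃; _×_; _,_; proj₁; proj₂)
open import Data.Sum.Base using (inj₁; inj₂)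
open import Function.Bundles using (Func; Bijection; Injection)
open import Function.Construct.Identity using (function)
open import Induction.WellFounded using (WellFounded; Acc; acc)
open import Level using (Level; suc; _⊔_)
open import Relation.Binary.Bundles using (Setoid)
open import Relation.Binary.Core using (Rel)
open import Relation.Binary.Definitions using (Monotonic₁; tri<; tri≈; tri>)
open import Relation.Binary.PropositionalEquality
  using (_≡_; refl; sym; subst; subst₂; setoid; _→-setoid_)
open import Relation.Binary.Structures using (IsStrictTotalOrder)
open import Relation.Nullary using (¬_; yes; no)
open import Relation.Unary using (Pred; _∈_; _⊆_; _≐_; U)
open import Relation.Unary.Properties using (≐-refl; ≐-sym; ≐-trans)
open import Relation.Unary.Relation.Binary.Equality using (≐-setoid)
import Relation.Binary.Construct.On as On
import Relation.Binary.Construct.StrictToNonStrict as StrictToNonStrict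

------------------------------------------------------------------------
-- Relational systems and Tukey connections

-- X and Y are setoids because a subset of κ is a predicate, considered up to
-- extensional equality; the relation, and the two maps of a Tukey connection,
-- are accordingly required to respect these equalities.

record RelationalSystem x y e r : Set (suc (x ⊔ y ⊔ e ⊔ r)) where
  field
    X : Setoid x e
    Y : Setoid y e
  private
    module X = Setoid X
    module Y = Setoid Y
  field
    R      : X.Carrier → Y.Carrier → Set r
    R-resp : ∀ {a a′ b b′} → a X.≈ a′ → b Y.≈ b′ → R a b → R a′ b′

infix 25 _^⊥

_^⊥ : ∀ {x y e r} → RelationalSystem x y e r → RelationalSystem y x e r
𝓡 ^⊥ = record
  { X      = Y
  ; Y      = X
  ; R      = λ y x → ¬ R x y
  ; R-resp = λ p q ¬r r → ¬r (R-resp (Setoid.sym X q) (Setoid.sym Y p) r)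
  }
  where open RelationalSystem 𝓡

infix 4 _⪯_

record _⪯_ {x y e r x′ y′ e′ r′}
           (𝓡 : RelationalSystem x y e r) (𝓡′ : RelationalSystem x′ y′ e′ r′)
           : Set (x ⊔ y ⊔ e ⊔ r ⊔ x′ ⊔ y′ ⊔ e′ ⊔ r′) where
  private
    module 𝓡  = RelationalSystem 𝓡
    module 𝓡′ = RelationalSystem 𝓡′
  field
    ρ₋    : Func 𝓡.X 𝓡′.X
    ρ₊    : Func 𝓡′.Y 𝓡.Y
    tukey : ∀ x y′ → 𝓡′.R (Func.to ρ₋ x) y′ → 𝓡.R x (Func.to ρ₊ y′)

------------------------------------------------------------------------
-- The ordinal κ is a well-ordered type; its elements are the ordinals below κ.

record WellOrder ℓ : Set (suc ℓ) where
  infix 4 _<_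
  field
    Carrier            : Set ℓ
    _<_                : Rel Carrier ℓ
    isStrictTotalOrder : IsStrictTotalOrder _≡_ _<_
    wellFounded        : WellFounded _<_

  open IsStrictTotalOrder isStrictTotalOrder public using (compare)
  open StrictToNonStrict _≡_ _<_ public using (_≤_)

-- The ambient set theory is classical; excluded middle is used here to define
-- cofinality as a function.

module Ordinals {ℓ} (em : ExcludedMiddle ℓ) (κ : WellOrder ℓ) where

  open WellOrder κ public

  private
    K : Set ℓ
    K = Carrier

    variable
      a p : Level

  least : (P : Pred K ℓ) → ∃ P → ∃ λ m → P m × (∀ x → P x → m ≤ x)
  least P (x , Px) = go x (wellFounded x) Px
    where
    go : ∀ x → Acc _<_ x → P x → ∃ λ m → P m × (∀ x → P x → m ≤ x)
    go x (acc rs) Px with em {P = ∃ λ y → y < x × P y}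
    ... | yes (y , y<x , Py) = go y (rs y<x) Py
    ... | no none = x , Px , below
      where
      below : ∀ y → P y → x ≤ y
      below y Py with compare x y
      ... | tri< x<y _ _ = inj₁ x<y
      ... | tri≈ _ x≡y _ = inj₂ x≡y
      ... | tri> _ _ y<x = ⊥-elim (none (y , y<x , Py))

  -- The von Neumann ordinal δ = {x ∣ x < δ}.  An ordinal δ ≤ κ is given by an
  -- initial segment of κ: ↓ δ if δ < κ, and U if δ = κ.

  ↓_ : K → Pred K ℓ
  (↓ δ) x = x < δ

  -- A subset of κ as a set in its own right: proofs of membership are ignored.

  ⟨_⟩ : Pred K p → Setoid (ℓ ⊔ p) ℓ
  ⟨ P ⟩ = On.setoid {B = Σ K P} (setoid K) proj₁

  -- The power set of a subset of κ.

  𝓟 : Pred K ℓ → Setoid (suc ℓ) ℓ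
  𝓟 P = On.setoid {B = Σ (Pred K ℓ) (_⊆ P)} (≐-setoid K ℓ) proj₁

  Nonzero : K → Set ℓ
  Nonzero δ = ∃ λ x → x < δ

  Limit : K → Set ℓ
  Limit γ = Nonzero γ × (∀ x → x < γ → ∃ λ y → x < y × y < γ)

  -- ⋃ S, for S a set of ordinals, is its least upper bound.

  IsUpperBound : K → Pred K ℓ → Set ℓ
  IsUpperBound σ S = ∀ x → x ∈ S → x ≤ σ

  IsSupremum : K → Pred K ℓ → Set ℓ
  IsSupremum σ S = IsUpperBound σ S × (∀ τ → IsUpperBound τ S → σ ≤ τ)

  ----------------------------------------------------------------------
  -- Cardinals

  IsCardinal : Pred K p → Set (ℓ ⊔ p)
  IsCardinal O = ∀ μ → μ ∈ O → ¬ Bijection ⟨ ↓ μ ⟩ ⟨ O ⟩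

  Infinite : Pred K p → Set (ℓ ⊔ p)
  Infinite O = ¬ (∃ λ n → Bijection ⟨ O ⟩ (setoid (Fin n)))

  Uncountable : Pred K p → Set (ℓ ⊔ p)
  Uncountable O = ¬ Injection ⟨ O ⟩ (setoid ℕ)

  infix 4 ∣_∣≡_ ∣_∣<_

  ∣_∣≡_ : Setoid a ℓ → K → Set (a ⊔ ℓ)
  ∣ S ∣≡ μ = IsCardinal (↓ μ) × Bijection S ⟨ ↓ μ ⟩

  ∣_∣<_ : Setoid a ℓ → K → Set (a ⊔ ℓ)
  ∣ S ∣< ν = ∃ λ μ → ∣ S ∣≡ μ × μ < ν

  HasCofinalMapFrom : Pred K p → K → Set (ℓ ⊔ p)
  HasCofinalMapFrom O μ =
    Σ (Func ⟨ ↓ μ ⟩ ⟨ O ⟩) λ f →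
      ∀ y → y ∈ O → ∃ λ i → y ≤ proj₁ (Func.to f i)

  cf : K → K
  cf δ = proj₁ (least (HasCofinalMapFrom (↓ δ))
    (δ , function ⟨ ↓ δ ⟩ , λ y y<δ → (y , y<δ) , inj₂ refl))

  IsRegularCardinal : K → Set ℓ
  IsRegularCardinal δ = IsCardinal (↓ δ) × Infinite (↓ δ) × cf δ ≡ δ

  -- κ is an uncountable cardinal, is regular (cf(κ) = κ), and 2^λ < κ for every
  -- cardinal λ < κ.

  record Inaccessible : Set (suc ℓ) where
    field
      isCardinal  : IsCardinal (U {A = K})
      uncountable : Uncountable (U {A = K})
      regular     : ∀ μ → ¬ HasCofinalMapFrom (U {A = K}) μ
      strongLimit : ∀ δ → IsCardinal (↓ δ) → ∃ λ μ → ∣ 𝓟 (↓ δ) ∣≡ μ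

  ----------------------------------------------------------------------
  -- Subsets of κ

  Bounded : Pred K p → Set (ℓ ⊔ p)
  Bounded A = ∃ λ β → ∀ α → α ∈ A → α ≤ β

  AlmostAll : Pred K p → Set (ℓ ⊔ p)
  AlmostAll A = ∃ λ β → ∀ α → β < α → α ∈ A

  CofinallyMany : Pred K p → Set (ℓ ⊔ p)
  CofinallyMany A = ∀ β → ∃ λ α → β < α × α ∈ A

  Closed : Pred K p → Set (ℓ ⊔ p)
  Closed C = ∀ γ → Limit γ →
    (∀ β → β < γ → ∃ λ α → β < α × α < γ × α ∈ C) → γ ∈ C

  Club : Pred K p → Set (ℓ ⊔ p)
  Club C = Closed C × CofinallyMany C

  ----------------------------------------------------------------------
  -- Functions on κ

  Increasing : (K → K) → Set ℓ
  Increasing = Monotonic₁ _≤_ _≤_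

  DiscontinuousOn : (K → K) → Pred K p → Set (ℓ ⊔ p)
  DiscontinuousOn g A = ∀ γ → γ ∈ A → Limit γ →
    ∃ λ σ → IsSupremum σ (λ x → ∃ λ α → α < γ × g α ≡ x) × σ < g γ

  ∏ : (K → K) → Setoid ℓ ℓ
  ∏ b = On.setoid {B = ∀ α → Σ K (_< b α)} (K →-setoid K) (λ f α → proj₁ (f α))

  record Slalom (b h : K → K) : Set (suc ℓ) where
    field
      slice   : K → Pred K ℓ
      slice⊆b : ∀ α → slice α ⊆ ↓ b α
      ∣slice∣ : ∀ α → ∣ ⟨ slice α ⟩ ∣< h α

  open Slalom public

  Loc : (b h : K → K) → Setoid (suc ℓ) ℓ
  Loc b h = record
    { Carrier       = Slalom b h
    ; _≈_           = λ φ ψ → ∀ α → slice φ α ≐ slice ψ α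
    ; isEquivalence = record
      { refl  = λ _ → ≐-refl
      ; sym   = λ e α → ≐-sym (e α)
      ; trans = λ e e′ α → ≐-trans (e α) (e′ α)
      }
    }

  module _ {b : K → K} where

    private
      F : Set ℓ
      F = Setoid.Carrier (∏ b)

    infix 4 _≤*_ _=∞_ _≠∞_ _∈*_ _∋∞_ _∌∞_

    _≤*_ : F → F → Set ℓ
    f ≤* g = AlmostAll λ α → proj₁ (f α) ≤ proj₁ (g α)

    _=∞_ : F → F → Set ℓ
    f =∞ g = CofinallyMany λ α → proj₁ (f α) ≡ proj₁ (g α)

    _≠∞_ : F → F → Set ℓ
    f ≠∞ g = ¬ (f =∞ g)

    _∈*_ : ∀ {h} → F → Slalom b h → Set ℓ
    f ∈* φ = AlmostAll λ α → proj₁ (f α) ∈ slice φ α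

    _∋∞_ : ∀ {h} → Slalom b h → F → Set ℓ
    φ ∋∞ f = CofinallyMany λ α → proj₁ (f α) ∈ slice φ α

    _∌∞_ : ∀ {h} → Slalom b h → F → Set ℓ
    φ ∌∞ f = ¬ (φ ∋∞ f)

  𝓓 : (b : K → K) → RelationalSystem ℓ ℓ ℓ ℓ
  𝓓 b = record
    { X      = ∏ b
    ; Y      = ∏ b
    ; R      = _≤*_
    ; R-resp = λ p q (β , r) → β , λ α β<α → subst₂ _≤_ (p α) (q α) (r α β<α)
    }

  𝓔𝓓 : (b : K → K) → RelationalSystem ℓ ℓ ℓ ℓ
  𝓔𝓓 b = record
    { X      = ∏ b
    ; Y      = ∏ b
    ; R      = _≠∞_
    ; R-resp = λ p q f≠g f=g → f≠g λ β →
        let α , β<α , e = f=g β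
        in α , β<α , subst₂ _≡_ (sym (p α)) (sym (q α)) e
    }

  𝓛 : (b h : K → K) → RelationalSystem ℓ (suc ℓ) ℓ ℓ
  𝓛 b h = record
    { X      = ∏ b
    ; Y      = Loc b h
    ; R      = _∈*_
    ; R-resp = λ {_} {_} {_} {ψ} p q (β , r) → β , λ α β<α →
        subst (_∈ slice ψ α) (p α) (proj₁ (q α) (r α β<α))
    }

  𝓐𝓛 : (b h : K → K) → RelationalSystem (suc ℓ) ℓ ℓ ℓ
  𝓐𝓛 b h = record
    { X      = Loc b h
    ; Y      = ∏ b
    ; R      = _∌∞_
    ; R-resp = λ {φ} p q φ∌f φ∋f → φ∌f λ β →
        let α , β<α , f∈φ = φ∋f β
        in α , β<α , subst (_∈ slice φ α) (sym (q α)) (proj₂ (p α) f∈φ)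
    }

{-# OPTIONS --safe #-}
module Submission where

-- All seven connections are built from three maps: the identity, f ↦ {f(α)},
-- and the map sending a slalom φ to the least function strictly above it.  The
-- latter exists at α as soon as |φ(α)| < cf(b(α)).  For singletons this is
-- 1 < cf(b(α)), which (1) provides for almost all α; for arbitrary slaloms it
-- is the extra hypothesis h(α) ≤ cf(b(α)).  Condition (2) gives h(α) > 1 for
-- almost all α, so that singletons are admissible slices.

open import Defs
open import Axiom.ExcludedMiddle using (ExcludedMiddle)
open import Data.Empty using (⊥-elim)
open import Data.Product.Base using (∃; _×_; _,_; proj₁; proj₂)
open import Data.Sum.Base using (inj₁; inj₂; [_,_]′)
open import Data.Unit.Polymorphic.Base using (⊤; tt)
open import Function.Base using (const; id; _∘_)
open import Function.Bundles using (Func; Bijection; Inverse)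
open import Function.Construct.Composition using (function)
open import Function.Construct.Identity renaming (function to identity)
open import Function.Properties.Bijection using (Bijection⇒Inverse)
open import Relation.Binary.Definitions using (Trans; Antisymmetric; tri<; tri≈; tri>)
open import Relation.Binary.PropositionalEquality
  using (_≡_; refl; sym; trans; subst; isEquivalence)
open import Relation.Binary.Structures using (IsStrictTotalOrder)
open import Relation.Nullary using (¬_; yes; no; contradiction)
open import Relation.Nullary.Decidable using (decidable-stable)
open import Relation.Unary using (Pred; _∈_; _⊆_; _≐_; _∪_; ∁)
import Relation.Binary.Construct.StrictToNonStrict as StrictToNonStrict

module Properties {ℓ} (em : ExcludedMiddle ℓ) (κ : WellOrder ℓ) where

  open Ordinals em κ
  open IsStrictTotalOrder isStrictTotalOrder
    using (irrefl; <-respˡ-≈; <-respʳ-≈) renaming (trans to <-trans) public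

  -- Strict and weak order on `κ`

  <-≤-trans : Trans _<_ _≤_ _<_
  <-≤-trans = StrictToNonStrict.<-≤-trans _≡_ _<_ <-trans <-respʳ-≈

  ≤-<-trans : Trans _≤_ _<_ _<_
  ≤-<-trans = StrictToNonStrict.≤-<-trans _≡_ _<_ sym <-trans <-respˡ-≈

  ≤-antisym : Antisymmetric _≡_ _≤_
  ≤-antisym = StrictToNonStrict.antisym _≡_ _<_ isEquivalence <-trans irrefl

  <⇒≱ : ∀ {x y} → x < y → ¬ y ≤ x
  <⇒≱ x<y y≤x = irrefl refl (<-≤-trans x<y y≤x)

  ≮⇒≥ : ∀ {x y} → ¬ x < y → y ≤ x
  ≮⇒≥ {x} {y} x≮y with compare x y
  ... | tri< x<y _ _ = contradiction x<y x≮y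
  ... | tri≈ _ x≡y _ = inj₂ (sym x≡y)
  ... | tri> _ _ y<x = inj₁ y<x

  -- Supplies an index beyond two thresholds at once, as needed whenever "almost all" is combined
  -- with "almost all" or "cofinally many".
  above₂ : (∀ x → ∃ λ y → x < y) → ∀ x y → ∃ λ z → x < z × y < z
  above₂ above x y with compare x y
  ... | tri< x<y _ _ = let z , y<z = above y in z , <-trans x<y y<z , y<z
  ... | tri≈ _ refl _ = let z , x<z = above x in z , x<z , x<z
  ... | tri> _ _ y<x = let z , x<z = above x in z , x<z , <-trans y<x x<z

  -- Choosing least elements makes a choice extensional, which is what lets `strictBound` respect
  -- equality of slaloms.
  least-cong : ∀ {P Q : Pred Carrier ℓ} (p : ∃ P) (q : ∃ Q) → P ≐ Q →
               proj₁ (least P p) ≡ proj₁ (least Q q)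
  least-cong {P} {Q} p q (P⊆Q , Q⊆P) =
    let m , Pm , m≤ = least P p
        n , Qn , n≤ = least Q q
    in ≤-antisym (m≤ n (Q⊆P Qn)) (n≤ m (P⊆Q Pm))

  -- Strict bounds and cofinality

  IsStrictBound : Carrier → Pred Carrier ℓ → Pred Carrier ℓ
  IsStrictBound δ S y = y < δ × (∀ x → x ∈ S → x < y)

  -- If `S` has no strict bound below `δ`, then each `y < δ` fails to be one and so is at most some
  -- element of `S`. An enumeration of `S` by `μ` is then cofinal in `δ`, against the minimality of
  -- `cf δ`.
  ∣S∣<cf⇒strictlyBounded : ∀ {δ} {S : Pred Carrier ℓ} → S ⊆ ↓ δ →
                           ∣ ⟨ S ⟩ ∣< cf δ → ∃ (IsStrictBound δ S)
  ∣S∣<cf⇒strictlyBounded {δ} {S} S⊆δ (μ , (_ , S⤖μ) , μ<cf)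
    with em {P = ∃ (IsStrictBound δ S)}
  ... | yes bounded = bounded
  ... | no unbounded = contradiction cf≤μ (<⇒≱ μ<cf)
    where
    open Inverse (Bijection⇒Inverse S⤖μ)

    enumeration : Func ⟨ ↓ μ ⟩ ⟨ ↓ δ ⟩
    enumeration = record
      { to   = λ i → proj₁ (from i) , S⊆δ (proj₂ (from i))
      ; cong = from-cong
      }

    cofinal : ∀ y → y < δ → ∃ λ i → y ≤ proj₁ (from i)
    cofinal y y<δ with em {P = ∃ λ x → x ∈ S × y ≤ x}
    ... | yes (x , x∈S , y≤x) =
      to (x , x∈S) , subst (y ≤_) (sym (strictlyInverseʳ (x , x∈S))) y≤x
    ... | no none = ⊥-elim (unbounded (y , y<δ , λ x x∈S →
      decidable-stable em λ x≮y → none (x , x∈S , ≮⇒≥ x≮y)))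

    cf≤μ : cf δ ≤ μ
    cf≤μ = proj₂ (proj₂ (least (HasCofinalMapFrom (↓ δ)) _)) μ
      (enumeration , cofinal)

  -- The cardinals 0 and 1

  module Numerals (inhabitant : Carrier) (above : ∀ x → ∃ λ y → x < y) where

    zero one : Carrier
    zero = proj₁ (least (λ _ → ⊤) (inhabitant , tt))
    one  = proj₁ (least (zero <_) (above zero))

    zero≤ : ∀ x → zero ≤ x
    zero≤ x = proj₂ (proj₂ (least _ (inhabitant , tt))) x tt

    zero<one : zero < one
    zero<one = proj₁ (proj₂ (least (zero <_) (above zero)))

    zero<⇒one≤ : ∀ {x} → zero < x → one ≤ x
    zero<⇒one≤ = proj₂ (proj₂ (least (zero <_) (above zero))) _

    <one⇒≡zero : ∀ {x} → x < one → x ≡ zero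
    <one⇒≡zero {x} x<one = ≤-antisym
      (≮⇒≥ λ zero<x → <⇒≱ x<one (zero<⇒one≤ zero<x)) (zero≤ x)

    nonzero⇒zero< : ∀ {x} → Nonzero x → zero < x
    nonzero⇒zero< (y , y<x) = ≤-<-trans (zero≤ y) y<x

    zero-isCardinal : IsCardinal (↓ zero)
    zero-isCardinal μ μ<zero = contradiction (zero≤ μ) (<⇒≱ μ<zero)

    one-isCardinal : IsCardinal (↓ one)
    one-isCardinal μ μ<one bij with <one⇒≡zero μ<one
    -- Now `μ` is `zero`, and the bijection would send the empty set onto a set containing `zero`.
    ... | refl = let (x , x<zero) , _ = Bijection.surjective bij (zero , zero<one)
                 in <⇒≱ x<zero (zero≤ x)

    -- The cardinality is 1 or 0 according to whether `S` is inhabited, so `one < ν` is demanded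
    -- only in the inhabited case.
    subsingleton-card : ∀ {S : Pred Carrier ℓ} {ν} →
                        (∀ {x y} → x ∈ S → y ∈ S → x ≡ y) →
                        zero < ν → (∃ S → one < ν) → ∣ ⟨ S ⟩ ∣< ν
    subsingleton-card {S} unique zero<ν one<ν with em {P = ∃ S}
    ... | yes (x , x∈S) = one , (one-isCardinal , record
      { to        = λ _ → zero , zero<one
      ; cong      = λ _ → refl
      ; bijective = (λ {(_ , y∈S)} {(_ , z∈S)} _ → unique y∈S z∈S)
                  , (λ (_ , y<one) → (x , x∈S) , λ _ → sym (<one⇒≡zero y<one))
      }) , one<ν (x , x∈S)
    ... | no empty = zero , (zero-isCardinal , record
      { to        = λ s → ⊥-elim (empty s)
      ; cong      = λ {s} _ → ⊥-elim (empty s)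
      ; bijective = (λ {s} _ → ⊥-elim (empty s))
                  , (λ (y , y<zero) → contradiction (zero≤ y) (<⇒≱ y<zero))
      }) , zero<ν

  -- Least strict bounds of slaloms

  module Maps (b h : Carrier → Carrier) (h≤b : ∀ α → h α ≤ b α)
              (h≢0 : ∀ α → Nonzero (h α)) where

    private
      StrictlyBounded : Slalom b h → Carrier → Set ℓ
      StrictlyBounded φ α = ∃ (IsStrictBound (b α) (slice φ α))

      -- Stated so as to be satisfiable even if φ α is unbounded in b α.
      Candidate : Slalom b h → Carrier → Pred Carrier ℓ
      Candidate φ α y = y < b α ×
        (StrictlyBounded φ α → IsStrictBound (b α) (slice φ α) y)

      candidate : ∀ φ α → ∃ (Candidate φ α)
      candidate φ α with em {P = StrictlyBounded φ α}
      ... | yes (y , y-bound) = y , proj₁ y-bound , const y-bound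
      -- Default value: any element of `h α` lies in `b α`, and the condition on strict bounds is
      -- vacuous.
      ... | no unbounded = let x , x<h = h≢0 α in
        x , <-≤-trans x<h (h≤b α) , ⊥-elim ∘ unbounded

      Candidate-mono : ∀ φ ψ α → slice φ α ≐ slice ψ α →
                       Candidate φ α ⊆ Candidate ψ α
      Candidate-mono _ _ _ (φ⊆ψ , ψ⊆φ) (y<b , bound) = y<b , λ (z , z<b , ψ<z) →
        y<b , λ x x∈ψ → proj₂ (bound (z , z<b , λ w w∈φ → ψ<z w (φ⊆ψ w∈φ))) x (ψ⊆φ x∈ψ)

    strictBound : Func (Loc b h) (∏ b)
    strictBound = record
      { to   = λ φ α →
          let m , (m<b , _) , _ = least (Candidate φ α) (candidate φ α) in m , m<b
      ; cong = λ {φ} {ψ} φ≈ψ α → least-cong (candidate φ α) (candidate ψ α)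
          ( Candidate-mono φ ψ α (φ≈ψ α)
          , Candidate-mono ψ φ α (proj₂ (φ≈ψ α) , proj₁ (φ≈ψ α)) )
      }

    slice<strictBound : ∀ φ {α x} → ∣ ⟨ slice φ α ⟩ ∣< cf (b α) → x ∈ slice φ α →
                        x < proj₁ (Func.to strictBound φ α)
    slice<strictBound φ {α} {x} ∣φ∣<cf x∈φ =
      let _ , (_ , bound) , _ = least (Candidate φ α) (candidate φ α)
      in proj₂ (bound (∣S∣<cf⇒strictlyBounded (slice⊆b φ α) ∣φ∣<cf)) x x∈φ

    -- Connections through singleton slaloms

    module Singletons (inhabitant : Carrier) (above : ∀ x → ∃ λ y → x < y) where

      open Numerals inhabitant above

      -- A singleton is replaced by ∅ where h α = 1.
      singleton : Func (∏ b) (Loc b h)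
      singleton = record
        { to   = λ f → record
          { slice   = λ α x → x ≡ proj₁ (f α) × one < h α
          ; slice⊆b = λ { α (refl , _) → proj₂ (f α) }
          ; ∣slice∣ = λ α → subsingleton-card (λ p q → trans (proj₁ p) (sym (proj₁ q)))
              (nonzero⇒zero< (h≢0 α)) (λ (_ , _ , one<h) → one<h)
          }
        ; cong = λ f≈g α → (λ (e , l) → trans e (f≈g α) , l)
                         , (λ (e , l) → trans e (sym (f≈g α)) , l)
        }

      ∣singleton∣< : ∀ f {α ν} → one < ν → ∣ ⟨ slice (Func.to singleton f) α ⟩ ∣< ν
      ∣singleton∣< f one<ν =
        subsingleton-card (λ p q → trans (proj₁ p) (sym (proj₁ q)))
          (<-trans zero<one one<ν) (const one<ν)

      -- The value at `α` is the ordinal successor of `f α` if `one < h α` and that successor is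
      -- below `b α`; otherwise it is `zero`.
      successor : Func (∏ b) (∏ b)
      successor = function singleton strictBound

      <successor : ∀ f {α} → one < h α → one < cf (b α) →
                   proj₁ (f α) < proj₁ (Func.to successor f α)
      <successor f one<h one<cf =
        slice<strictBound (Func.to singleton f) (∣singleton∣< f one<cf) (refl , one<h)

      module _ (large : AlmostAll λ α → one < h α × one < cf (b α)) where

        private
          β₀ = proj₁ large
          one<h : ∀ {α} → β₀ < α → one < h α
          one<h = proj₁ ∘ proj₂ large _

          f<successor : ∀ f {α} → β₀ < α → proj₁ (f α) < proj₁ (Func.to successor f α)
          f<successor f β₀<α =
            <successor f (one<h β₀<α) (proj₂ (proj₂ large _ β₀<α))

        𝓔𝓓⪯𝓐𝓛 : 𝓔𝓓 b ⪯ 𝓐𝓛 b h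
        𝓔𝓓⪯𝓐𝓛 = record
          { ρ₋    = singleton
          ; ρ₊    = identity (∏ b)
          -- Beyond `β₀` the slice is the true singleton of `f α`, not its empty replacement, so
          -- every agreement of `f` with `g` there puts `g α` into the slice.
          ; tukey = λ f g [f]∌g f=g → [f]∌g λ β →
              let γ , β<γ , β₀<γ = above₂ above β β₀
                  α , γ<α , fα≡gα = f=g γ
              in α , <-trans β<γ γ<α , sym fα≡gα , one<h (<-trans β₀<γ γ<α)
          }

        𝓔𝓓⪯𝓓 : 𝓔𝓓 b ⪯ 𝓓 b
        𝓔𝓓⪯𝓓 = record
          { ρ₋    = identity (∏ b)
          ; ρ₊    = successor
          -- Eventually `f ≤ g < successor g`, which rules out cofinally many agreements of `f` with
          -- `successor g`.
          ; tukey = λ f g (β , f≤g) f=g⁺ →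
              let γ , β<γ , β₀<γ = above₂ above β β₀
                  α , γ<α , f≡g⁺ = f=g⁺ γ
              in <⇒≱ (f<successor g (<-trans β₀<γ γ<α))
                     (subst (_≤ _) f≡g⁺ (f≤g α (<-trans β<γ γ<α)))
          }

        𝓓⊥⪯𝓓 : 𝓓 b ^⊥ ⪯ 𝓓 b
        𝓓⊥⪯𝓓 = record
          { ρ₋    = identity (∏ b)
          ; ρ₊    = successor
          -- At an index past all three thresholds, `f ≤ g < successor g ≤ f`.
          ; tukey = λ f g (β , f≤g) (β′ , g⁺≤f) →
              let γ , β<γ , β₀<γ = above₂ above β β₀
                  α , γ<α , β′<α = above₂ above γ β′
              in <⇒≱ (<-≤-trans (f<successor g (<-trans β₀<γ γ<α)) (g⁺≤f α β′<α))
                     (f≤g α (<-trans β<γ γ<α))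
          }

    -- Connections through arbitrary slaloms

    module Slaloms (above : ∀ x → ∃ λ y → x < y) where

      𝓐𝓛⊥⪯𝓛 : 𝓐𝓛 b h ^⊥ ⪯ 𝓛 b h
      𝓐𝓛⊥⪯𝓛 = record
        { ρ₋    = identity (∏ b)
        ; ρ₊    = identity (Loc b h)
        ; tukey = λ f φ (β , f∈φ) φ∌f → φ∌f λ β′ →
            let α , β<α , β′<α = above₂ above β β′ in α , β′<α , f∈φ α β<α
        }

      module _ (h≤cf : AlmostAll λ α → h α ≤ cf (b α)) where

        private
          β₀ = proj₁ h≤cf

          slice< : ∀ φ {α x} → β₀ < α → x ∈ slice φ α →
                   x < proj₁ (Func.to strictBound φ α)
          slice< φ {α} β₀<α =
            let μ , card , μ<h = ∣slice∣ φ α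
            in slice<strictBound φ (μ , card , <-≤-trans μ<h (proj₂ h≤cf α β₀<α))

        𝓐𝓛⪯𝓓 : 𝓐𝓛 b h ⪯ 𝓓 b
        𝓐𝓛⪯𝓓 = record
          { ρ₋    = strictBound
          ; ρ₊    = identity (∏ b)
          -- Eventually `g` is at least a strict bound of the slice, so it cannot take a value in
          -- it.
          ; tukey = λ φ g (β , φ⁺≤g) φ∋g →
              let γ , β<γ , β₀<γ = above₂ above β β₀
                  α , γ<α , g∈φ = φ∋g γ
              in <⇒≱ (slice< φ (<-trans β₀<γ γ<α) g∈φ) (φ⁺≤g α (<-trans β<γ γ<α))
          }

        𝓓⪯𝓛 : 𝓓 b ⪯ 𝓛 b h
        𝓓⪯𝓛 = record
          { ρ₋    = identity (∏ b)
          ; ρ₊    = strictBound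
          ; tukey = λ f φ (β , f∈φ) →
              let γ , β<γ , β₀<γ = above₂ above β β₀
              in γ , λ α γ<α →
                inj₁ (slice< φ (<-trans β₀<γ γ<α) (f∈φ α (<-trans β<γ γ<α)))
          }

        𝓓⊥⪯𝓐𝓛⊥ : 𝓓 b ^⊥ ⪯ 𝓐𝓛 b h ^⊥
        𝓓⊥⪯𝓐𝓛⊥ = record
          { ρ₋    = identity (∏ b)
          ; ρ₊    = strictBound
          -- The relation of the dual is a double negation; since the goal is also a negation,
          -- `φ ∋∞ f` may be assumed.
          ; tukey = λ f φ ¬φ∌f (β , φ⁺≤f) → ¬φ∌f λ φ∋f →
              let γ , β<γ , β₀<γ = above₂ above β β₀
                  α , γ<α , f∈φ = φ∋f γ
              in <⇒≱ (slice< φ (<-trans β₀<γ γ<α) f∈φ) (φ⁺≤f α (<-trans β<γ γ<α))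
          }

-- Thresholds extracted from the hypotheses

theorem4p1 : ∀ {ℓ} (em : ExcludedMiddle ℓ) (κ : WellOrder ℓ) →
    let open Ordinals em κ in
    Inaccessible →
    (b h : Carrier → Carrier) →
    Increasing b →
    Increasing h →
    (∀ α → h α ≤ b α) →
    (∀ α → IsCardinal (↓ b α) × Infinite (↓ b α)) →
    (∀ α → IsCardinal (↓ h α) × Nonzero (h α)) →
    -- (1)
    (∀ δ → IsRegularCardinal δ → Bounded (λ α → cf (b α) ≡ δ)) →
    (∃ λ (C : Pred Carrier ℓ) → Club C ×
      (∀ ξ → ξ ∈ C → ∀ α → ξ ≤ α → ξ < cf (b α))) →
    -- (2)
    (∀ δ → IsCardinal (↓ δ) → Bounded (λ α → h α ≡ δ)) →
    (∃ λ (C : Pred Carrier ℓ) → Club C × DiscontinuousOn h C) →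
    -- (3)
    (∀ δ → IsCardinal (↓ δ) →
      Bounded ((λ α → b α ≤ δ) ∪ (λ α → h α ≡ b α × cf (b α) ≤ δ))) →
    (∃ λ (C : Pred Carrier ℓ) → Club C × DiscontinuousOn b C ×
      (∀ ξ → ξ ∈ C → ∀ α → ξ ≤ α → h α ≡ b α → ξ < cf (b α))) →
    (𝓔𝓓 b ⪯ 𝓐𝓛 b h × 𝓔𝓓 b ⪯ 𝓓 b × 𝓓 b ^⊥ ⪯ 𝓓 b × 𝓐𝓛 b h ^⊥ ⪯ 𝓛 b h) ×
    (Bounded (∁ (λ α → h α ≤ cf (b α))) →
      𝓐𝓛 b h ⪯ 𝓓 b × 𝓓 b ⪯ 𝓛 b h × 𝓓 b ^⊥ ⪯ 𝓐𝓛 b h ^⊥)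
theorem4p1 em κ inaccessible b h _ _ h≤b _ h-card _ (C , (_ , C-cofinal) , C<cf)
  h-fibres _ _ _ =
    (𝓔𝓓⪯𝓐𝓛 large , 𝓔𝓓⪯𝓓 large , 𝓓⊥⪯𝓓 large , 𝓐𝓛⊥⪯𝓛) ,
    λ (β , small) →
      let h≤cf = β , λ α β<α → decidable-stable em λ h≰cf → <⇒≱ β<α (small α h≰cf)
      in 𝓐𝓛⪯𝓓 h≤cf , 𝓓⪯𝓛 h≤cf , 𝓓⊥⪯𝓐𝓛⊥ h≤cf
  where
  open Ordinals em κ
  open Properties em κ

  -- That `κ` has no greatest element is read off from the unboundedness of the club in (1).
  above : ∀ x → ∃ λ y → x < y
  above x = let y , x<y , _ = C-cofinal x in y , x<y

  inhabitant : Carrier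
  -- An empty `κ` would inject into the natural numbers.
  inhabitant = decidable-stable em λ empty → Inaccessible.uncountable inaccessible record
    { to        = λ (x , _) → ⊥-elim (empty x)
    ; cong      = λ {(x , _)} _ → ⊥-elim (empty x)
    ; injective = λ {(x , _)} _ → ⊥-elim (empty x)
    }

  open Numerals inhabitant above
  open Maps b h h≤b (proj₂ ∘ h-card)
  open Singletons inhabitant above
  open Slaloms above

  -- By (2), `h` takes the value 1 only boundedly often, and it is never 0. A point `ξ > 1` of the
  -- club in (1) gives `1 < ξ < cf (b α)` for all later `α`.
  large : AlmostAll λ α → one < h α × one < cf (b α)
  large =
    let β , h≡one⇒≤β    = h-fibres one one-isCardinal
        ξ , one<ξ , ξ∈C = C-cofinal one
        γ , β<γ , ξ<γ   = above₂ above β ξ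
    in γ , λ α γ<α →
      [ id
      , (λ one≡h → contradiction (h≡one⇒≤β α (sym one≡h)) (<⇒≱ (<-trans β<γ γ<α)))
      ]′ (zero<⇒one≤ (nonzero⇒zero< (proj₂ (h-card α))))
      , <-trans one<ξ (C<cf ξ ξ∈C α (inj₁ (<-trans ξ<γ γ<α)))
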